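{- For every odd $n\ge 3$ there exists an integer cyclically $3$-diagonal $\mathrm{H}_{2n}(n;3)$.
   Context: A partially filled (p.f.) array is a matrix in which some cells may be empty. Let $n\ge k\ge 3$, let $t$ divide $2nk$, put $v=2nk+t$ and let $J$ be the subgroup of $\mathbb{Z}_v$ of order $t$. An $\mathrm{H}_t(n;k)$ (square relative Heffter array) is an $n\times n$ p.f. array with elements in $\mathbb{Z}_v$ such that each row and each column has exactly $k$ filled cells; for every $x\in\mathbb{Z}_v\setminus J$ either $x$ or $-x$ appears in the array; and the elements of every row and column sum to $0$. It is integer if moreover the elements of every row and column, viewed as integers in $\pm\{1,\dots,\lfloor\frac{2nk+t}{2}\rfloor\}$, sum to $0$ in $\mathbb{Z}$. For an $n\times n$ array and $i\in\{1,\dots,n\}$, the $i$-th diagonal is $D_i=\{(i,1),(i+1,2),\dots,(i-1,n)\}$, indices taken modulo $n$ in $\{1,\dots,n\}$. Diagonals $D_i,D_{i+1},\dots,D_{i+r}$ (indices mod $n$) are consecutive. A p.f. array of size $n\ge k$ is cyclically $k$-diagonal if its nonempty cells are exactly those of $k$ consecutive diagonals. -}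

module Defs where

open import Data.Bool.Base using (if_then_else_)
open import Data.Fin.Base using (Fin; toℕ)
open import Data.Fin.Properties using (nonZeroIndex)
open import Data.Fin.Subset using (Subset; _∈_; _∉_; ∣_∣)
open import Data.Integer.Base as ℤ using (ℤ; +_; _⊖_; 0ℤ)
open import Data.Maybe using (Maybe; just; maybe′; is-just; Is-just)
open import Data.Nat.Base
  using (ℕ; _+_; _*_; _∸_; _≤_; _<_; _≤ᵇ_; ⌊_/2⌋; NonZero; z≤n; s≤s; >-nonZero)
open import Data.Nat.Divisibility using (_∣_)
open import Data.Nat.DivMod using (_mod_)
open import Data.Nat.Properties using (≤-trans; *-mono-≤; m≤m+n)
open import Data.Product using (∃-syntax; _×_)
open import Data.Sum using (_⊎_)
import Data.Vec as Vec
open import Data.Vec.Functional using (Vector; foldr; transpose)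
open import Function using (_∘_; id; _⇔_)
open import Relation.Binary.PropositionalEquality using (_≡_)

-- The cyclic group ℤ_v, carried by the residues 0, …, v - 1.

ℤ/ : ℕ → Set
ℤ/ v = Fin v

module _ {v : ℕ} .{{_ : NonZero v}} where

  infixl 6 _⊕_
  infix  8 ⊝_

  𝟘 : ℤ/ v
  𝟘 = 0 mod v

  _⊕_ : ℤ/ v → ℤ/ v → ℤ/ v
  x ⊕ y = (toℕ x + toℕ y) mod v

  ⊝_ : ℤ/ v → ℤ/ v
  ⊝ x = (v ∸ toℕ x) mod v

  record IsSubgroup (J : Subset v) : Set where
    field
      𝟘-mem    : 𝟘 ∈ J
      ⊕-closed : ∀ {x y} → x ∈ J → y ∈ J → x ⊕ y ∈ J
      ⊝-closed : ∀ {x} → x ∈ J → ⊝ x ∈ J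

-- The representative z of the class x with - v / 2 < z ≤ v / 2.  For
-- 0 ≠ x it is the one in ±{1, …, ⌊ v / 2 ⌋}; the only class with two
-- representatives there is v / 2, for v even.  Neither 0 nor v / 2 occurs in
-- a relative Heffter array: both lie in J, and the n * k filled cells are
-- used up by the n * k pairs {x , - x} outside J.

signed : ∀ {v} → ℤ/ v → ℤ
signed {v} x = if toℕ x ≤ᵇ ⌊ v /2⌋ then + toℕ x else toℕ x ⊖ v

-- Square partially filled arrays; `nothing` is an empty cell and A r is row r.
-- Rows, columns and diagonals are numbered from 0.

PFArray : Set → ℕ → Set
PFArray X n = Vector (Vector (Maybe X) n) n

module _ {X : Set} {n : ℕ} where

  filledCount : Vector (Maybe X) n → ℕ
  filledCount line = ∣ Vec.tabulate (is-just ∘ line) ∣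

  _AppearsIn_ : X → PFArray X n → Set
  x AppearsIn A = ∃[ r ] ∃[ c ] A r c ≡ just x

  EveryLine : (Vector (Maybe X) n → Set) → PFArray X n → Set
  EveryLine P A = (∀ r → P (A r)) × (∀ c → P (transpose A c))

sumMod : ∀ {v n} .{{_ : NonZero v}} → Vector (Maybe (ℤ/ v)) n → ℤ/ v
sumMod = foldr (maybe′ _⊕_ id) 𝟘

sumSigned : ∀ {v n} → Vector (Maybe (ℤ/ v)) n → ℤ
sumSigned = foldr (maybe′ (λ x s → signed x ℤ.+ s) id) 0ℤ

modulus : (t n k : ℕ) → ℕ
modulus t n k = 2 * n * k + t

modulus-nonZero : ∀ {t n k} → 3 ≤ k → k ≤ n → NonZero (modulus t n k)
modulus-nonZero {t} {n} {k} 3≤k k≤n = >-nonZero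
  (≤-trans (*-mono-≤ {1} {2 * n} {1} {k}
              (*-mono-≤ {1} {2} {1} {n} (s≤s z≤n) (≤-trans 1≤k k≤n)) 1≤k)
           (m≤m+n (2 * n * k) t))
  where
  1≤k : 1 ≤ k
  1≤k = ≤-trans (s≤s z≤n) 3≤k

-- A is an H_t(n; k).  A cyclic group has at most one subgroup of each order,
-- so having J as a field leaves no choice.

record IsHeffter (t n k : ℕ) (A : PFArray (ℤ/ (modulus t n k)) n) : Set where
  field
    3≤k   : 3 ≤ k
    k≤n   : k ≤ n
    t∣2nk : t ∣ 2 * n * k

  instance
    v≢0 : NonZero (modulus t n k)
    v≢0 = modulus-nonZero {t} 3≤k k≤n

  field
    J          : Subset (modulus t n k)
    J-subgroup : IsSubgroup J
    J-order    : ∣ J ∣ ≡ t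
    k-filled   : EveryLine (λ line → filledCount line ≡ k) A
    covers     : ∀ x → x ∉ J → (x AppearsIn A) ⊎ ((⊝ x) AppearsIn A)
    sums-to-0  : EveryLine (λ line → sumMod line ≡ 𝟘) A

IsInteger : ∀ {v n} → PFArray (ℤ/ v) n → Set
IsInteger = EveryLine (λ line → sumSigned line ≡ 0ℤ)

-- Cell (r , c) lies on the diagonal of index i mod n, whose cell in column 0
-- is in row i mod n.

OnDiagonal : ∀ {n} → ℕ → Fin n → Fin n → Set
OnDiagonal {n} i r c = r ≡ ((i + toℕ c) mod n) {{nonZeroIndex r}}

record IsCyclicallyDiagonal {X : Set} {n : ℕ} (k : ℕ) (A : PFArray X n) : Set where
  field
    size       : k ≤ n
    start      : Fin n
    filled-iff : ∀ r c →
      Is-just (A r c) ⇔ (∃[ j ] j < k × OnDiagonal (toℕ start + j) r c)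

{-# OPTIONS --safe #-}
module Submission where

-- Write n = 2m + 1, so that v = 8n and J = 4ℤ/v.  The sequence
-- φ = 0, -m, 1, 1 - m, 2, 2 - m, …, -1, m  enumerates [-m, m] and satisfies
-- φ i + φ (i + 1) = i - m for all i, also cyclically.  For any sequence d the array with
-- d (i + 1) + 2, - (d i + d (i + 1)), d i - 2 in row i, on three consecutive diagonals, has
-- zero row and column sums.  Taking d = 8φ + 1, its entries are 8 φ (i + 1) + 3, 8 (m - i) - 2
-- and 8 φ i - 1, which exhaust the classes 3, 6 and 7 mod 8 in ℤ/v; their negatives exhaust
-- 5, 2 and 1.  All entries have absolute value below 4n, so each is the signed
-- representative of its class.

open import Defs
open import Algebra.Bundles using (CommutativeMonoid)
import Algebra.Properties.CommutativeMonoid.Sum as Sum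
import Algebra.Properties.CommutativeSemigroup as CommutativeSemigroup
open import Data.Bool.Base using (true; false; if_then_else_; T)
open import Data.Fin.Base using (Fin; zero; suc; toℕ; fromℕ<)
open import Data.Fin.Patterns using (0F; 1F; 2F)
open import Data.Fin.Properties as Fin
  using (any?; toℕ-injective; toℕ-fromℕ<; toℕ<n; nonZeroIndex)
open import Data.Fin.Subset using (Subset; _∈_; _∉_; ∣_∣)
open import Data.Integer.Base as ℤ using (ℤ; +_; -[1+_]; 0ℤ; 1ℤ; -1ℤ; _⊖_)
open import Data.Integer.DivMod using (n%ℕd<d; a≡a%ℕn+[a/ℕn]*n)
import Data.Integer.Properties as ℤ
open import Data.Integer.Tactic.RingSolver using (solve-∀)
open import Data.Maybe using (Maybe; just; nothing; maybe′; Is-just)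
import Data.Maybe.Relation.Unary.Any as MaybeAny
open import Data.Nat
  using (ℕ; zero; suc; _+_; _*_; _∸_; _≤_; _<_; _%_; _/_; NonZero; z≤n; s≤s; s≤s⁻¹;
         _≡ᵇ_; _≤ᵇ_; ⌊_/2⌋; ⌈_/2⌉)
open import Data.Nat.DivMod using (_mod_; m%n<n; m≡m%n+[m/n]*n)
open import Data.Nat.Divisibility
  using (_∣_; _∣0; divides; m%n≡0⇒n∣m; n∣m⇒m%n≡0; ∣m∣n⇒∣m+n; ∣m+n∣m⇒∣n; m∣m*n; %-presˡ-∣)
import Data.Nat.Properties as ℕ
open import Data.Nat.Tactic.RingSolver using () renaming (solve-∀ to ℕ-solve-∀)
open import Data.Product using (∃-syntax; _×_; _,_; proj₁; proj₂)
open import Data.Unit.Base using (tt)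
open import Data.Sum using (_⊎_; inj₁; inj₂)
import Data.Vec as Vec
import Data.Vec.Properties as Vec
open import Data.Vec.Functional using (Vector)
open import Function using (_∘_; id; mk⇔)
open import Function.Definitions using (Injective)
open import Relation.Binary.PropositionalEquality hiding (setoid)
open import Relation.Nullary using (Dec; yes; no; does; contradiction)

open CommutativeSemigroup ℕ.+-commutativeSemigroup using ()
  renaming (interchange to +-interchange)

-- Sums over the filled cells of a line.

module _ {a ℓ} (M : CommutativeMonoid a ℓ) where
  open CommutativeMonoid M renaming (refl to ≈-refl; sym to ≈-sym; trans to ≈-trans)
  open Sum M

  sum-δ : ∀ {n} (p : Fin n) (y : Carrier) →
          sum (λ i → if does (p Fin.≟ i) then y else ε) ≈ y
  sum-δ {suc n} zero    y = ≈-trans (∙-congˡ (sum-replicate-zero n)) (identityʳ y)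
  sum-δ         (suc p) y = ≈-trans (identityˡ _) (sum-δ p y)

-- The positions need not increase with the index: sums in a commutative monoid ignore order, and a
-- row meets consecutive diagonals only in cyclic order.
record Enumerates {X : Set} {n k : ℕ} (line : Vector (Maybe X) n) (x : Vector X k) : Set where
  field
    position  : Fin k → Fin n
    injective : Injective _≡_ _≡_ position
    filled    : ∀ j → line (position j) ≡ just (x j)
    only      : ∀ i → Is-just (line i) → ∃[ j ] position j ≡ i

module _ {a ℓ} (M : CommutativeMonoid a ℓ) {X : Set} (f : X → CommutativeMonoid.Carrier M) where
  open CommutativeMonoid M renaming (refl to ≈-refl; sym to ≈-sym; trans to ≈-trans)
  open Sum M
  open import Relation.Binary.Reasoning.Setoid setoid

  -- Each cell is written as a sum of indicators over the `k` positions, and the two summations are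
  -- exchanged. The general monoid serves both the count of filled cells and the signed sum.
  sum-line : ∀ {n k} {line : Vector (Maybe X) n} {x : Vector X k} → Enumerates line x →
             sum (maybe′ f ε ∘ line) ≈ sum (f ∘ x)
  sum-line {n} {k} {line} {x} e = begin
    sum (maybe′ f ε ∘ line)          ≈⟨ sum-cong-≋ value ⟩
    ∑[ i < n ] ∑[ j < k ] cell i j   ≈⟨ ∑-comm cell ⟩
    ∑[ j < k ] ∑[ i < n ] cell i j   ≈⟨ sum-cong-≋ (λ j → sum-δ M (position j) (f (x j))) ⟩
    sum (f ∘ x)                      ∎
    where
    open Enumerates e

    cell : Fin n → Fin k → Carrier
    cell i j = if does (position j Fin.≟ i) then f (x j) else ε

    -- Injectivity turns the indicator of `j₀` among indices into the indicator of its cell among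
    -- positions, so a filled cell is counted once.
    cell-filled : ∀ j₀ j → (if does (j₀ Fin.≟ j) then f (x j₀) else ε) ≈ cell (position j₀) j
    cell-filled j₀ j with j₀ Fin.≟ j | position j Fin.≟ position j₀
    ... | yes refl | yes _  = ≈-refl
    ... | yes refl | no ¬p  = contradiction refl ¬p
    ... | no j₀≢j  | yes p  = contradiction (sym (injective p)) j₀≢j
    ... | no _     | no _   = ≈-refl

    cell-empty : ∀ i → line i ≡ nothing → ∀ j → ε ≈ cell i j
    cell-empty i eq j with position j Fin.≟ i
    ... | no _     = ≈-refl
    ... | yes refl with trans (sym eq) (filled j)
    ... | ()

    value : ∀ i → maybe′ f ε (line i) ≈ ∑[ j < k ] cell i j
    value i with line i in eq
    ... | nothing = ≈-trans (≈-sym (sum-replicate-zero k)) (sum-cong-≋ (cell-empty i eq))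
    ... | just y with only i (subst Is-just (sym eq) (MaybeAny.just tt))
    ... | j₀ , refl with trans (sym eq) (filled j₀)
    ... | refl = ≈-trans (≈-sym (sum-δ M j₀ (f (x j₀)))) (sum-cong-≋ (cell-filled j₀))

module ℤ-Sum = Sum ℤ.+-0-commutativeMonoid
module ℕ-Sum = Sum ℕ.+-0-commutativeMonoid

filledCount≡sum : ∀ {X : Set} {n} (line : Vector (Maybe X) n) →
                  filledCount line ≡ ℕ-Sum.sum (maybe′ (λ _ → 1) 0 ∘ line)
filledCount≡sum {n = zero}  line = refl
filledCount≡sum {n = suc n} line with line zero
... | just _  = cong suc (filledCount≡sum (line ∘ suc))
... | nothing = filledCount≡sum (line ∘ suc)

sum-1 : ∀ k → ℕ-Sum.sum {k} (λ _ → 1) ≡ k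
sum-1 zero    = refl
sum-1 (suc k) = cong suc (sum-1 k)

sumSigned≡sum : ∀ {v n} .{{_ : NonZero v}} (line : Vector (Maybe (ℤ/ v)) n) →
                sumSigned line ≡ ℤ-Sum.sum (maybe′ signed 0ℤ ∘ line)
sumSigned≡sum {n = zero}  line = refl
sumSigned≡sum {n = suc n} line with line zero
... | just x  = cong (ℤ._+_ (signed x)) (sumSigned≡sum (line ∘ suc))
... | nothing = trans (sumSigned≡sum (line ∘ suc)) (sym (ℤ.+-identityˡ _))

filledCount-enumerated : ∀ {X : Set} {n k} {line : Vector (Maybe X) n} {x : Vector X k} →
                         Enumerates line x → filledCount line ≡ k
filledCount-enumerated {k = k} {line} e =
  trans (filledCount≡sum line)
        (trans (sum-line ℕ.+-0-commutativeMonoid (λ _ → 1) e) (sum-1 k))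

sumSigned-enumerated : ∀ {v n k} .{{_ : NonZero v}} {line : Vector (Maybe (ℤ/ v)) n}
                         {x : Vector (ℤ/ v) k} →
                       Enumerates line x → sumSigned line ≡ ℤ-Sum.sum (signed ∘ x)
sumSigned-enumerated {line = line} e =
  trans (sumSigned≡sum line) (sum-line ℤ.+-0-commutativeMonoid signed e)

-- Congruence of integers.

infix 4 _≋_[mod_]

-- The quotient is kept as data, so that each closure rule reduces to a polynomial identity for the
-- ring solver.
record _≋_[mod_] (a b : ℤ) (n : ℕ) : Set where
  constructor _wraps_
  field
    quotient : ℤ
    equality : a ≡ b ℤ.+ quotient ℤ.* + n

infix 0 _wraps_

module _ {n : ℕ} where

  ≋-reflexive : ∀ {a b} → a ≡ b → a ≋ b [mod n ]
  ≋-reflexive {a} refl = 0ℤ wraps sym (ℤ.+-identityʳ a)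

  ≋-sym : ∀ {a b} → a ≋ b [mod n ] → b ≋ a [mod n ]
  ≋-sym {_} {b} (q wraps refl) = ℤ.- q wraps lemma b q (+ n)
    where
    lemma : ∀ b q n → b ≡ b ℤ.+ q ℤ.* n ℤ.+ (ℤ.- q) ℤ.* n
    lemma = solve-∀

  ≋-trans : ∀ {a b c} → a ≋ b [mod n ] → b ≋ c [mod n ] → a ≋ c [mod n ]
  ≋-trans {_} {_} {c} (q wraps refl) (p wraps refl) = p ℤ.+ q wraps lemma c p q (+ n)
    where
    lemma : ∀ c p q n → c ℤ.+ p ℤ.* n ℤ.+ q ℤ.* n ≡ c ℤ.+ (p ℤ.+ q) ℤ.* n
    lemma = solve-∀

  +-cong-≋ : ∀ {a b c d} → a ≋ b [mod n ] → c ≋ d [mod n ] → a ℤ.+ c ≋ b ℤ.+ d [mod n ]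
  +-cong-≋ {_} {b} {_} {d} (q wraps refl) (p wraps refl) = q ℤ.+ p wraps lemma b d q p (+ n)
    where
    lemma : ∀ b d q p n → b ℤ.+ q ℤ.* n ℤ.+ (d ℤ.+ p ℤ.* n) ≡ b ℤ.+ d ℤ.+ (q ℤ.+ p) ℤ.* n
    lemma = solve-∀

  neg-cong-≋ : ∀ {a b} → a ≋ b [mod n ] → ℤ.- a ≋ ℤ.- b [mod n ]
  neg-cong-≋ {_} {b} (q wraps refl) = ℤ.- q wraps lemma b q (+ n)
    where
    lemma : ∀ b q n → ℤ.- (b ℤ.+ q ℤ.* n) ≡ ℤ.- b ℤ.+ ℤ.- q ℤ.* n
    lemma = solve-∀

  *-congʳ-≋ : ∀ {a b} c → a ≋ b [mod n ] → a ℤ.* c ≋ b ℤ.* c [mod n ]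
  *-congʳ-≋ {_} {b} c (q wraps refl) = q ℤ.* c wraps lemma b c q (+ n)
    where
    lemma : ∀ b c q n → (b ℤ.+ q ℤ.* n) ℤ.* c ≡ b ℤ.* c ℤ.+ q ℤ.* c ℤ.* n
    lemma = solve-∀

  -- A nonzero multiple of n is too large to be a difference of residues.
  residue-unique : ∀ {a b} → a < n → b < n → + a ≋ + b [mod n ] → a ≡ b
  residue-unique {a} {b} a<n b<n (q wraps eq) = ℤ.+-injective
    (trans eq (trans (cong (λ z → + b ℤ.+ z ℤ.* + n) q≡0) (ℤ.+-identityʳ (+ b))))
    where
    difference : ∀ a b x → a ≡ b ℤ.+ x → a ℤ.- b ≡ x
    difference _ b x refl = lemma b x
      where
      lemma : ∀ b x → b ℤ.+ x ℤ.- b ≡ x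
      lemma = solve-∀

    ∣a⊖b∣<n : ℤ.∣ a ⊖ b ∣ < n
    ∣a⊖b∣<n = ℕ.≤-<-trans (ℤ.∣m⊝n∣≤m⊔n a b) (ℕ.⊔-pres-<m a<n b<n)

    ∣q∣*n<n : ℤ.∣ q ∣ * n < n
    ∣q∣*n<n = subst (_< n) (begin
      ℤ.∣ a ⊖ b ∣         ≡⟨ cong ℤ.∣_∣ (ℤ.m-n≡m⊖n a b) ⟨
      ℤ.∣ + a ℤ.- + b ∣   ≡⟨ cong ℤ.∣_∣ (difference (+ a) (+ b) (q ℤ.* + n) eq) ⟩
      ℤ.∣ q ℤ.* + n ∣     ≡⟨ ℤ.abs-* q (+ n) ⟩
      ℤ.∣ q ∣ * n         ∎) ∣a⊖b∣<n
      where open ≡-Reasoning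

    q≡0 : q ≡ 0ℤ
    q≡0 = ℤ.∣i∣≡0⇒i≡0 (ℕ.n<1⇒n≡0 (ℕ.*-cancelʳ-< n _ 1
      (subst (ℤ.∣ q ∣ * n <_) (sym (ℕ.*-identityˡ n)) ∣q∣*n<n)))

  toℕ-unique : {i j : Fin n} → + toℕ i ≋ + toℕ j [mod n ] → i ≡ j
  toℕ-unique {i} {j} i≋j = toℕ-injective (residue-unique (toℕ<n i) (toℕ<n j) i≋j)

  %ℕ-≋ : .{{_ : NonZero n}} → ∀ z → + (z ℤ.%ℕ n) ≋ z [mod n ]
  %ℕ-≋ z = ≋-sym (z ℤ./ℕ n wraps a≡a%ℕn+[a/ℕn]*n z n)

  toℕ-mod : .{{_ : NonZero n}} → ∀ a → + toℕ (a mod n) ≋ + a [mod n ]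
  toℕ-mod a = ≋-trans (≋-reflexive (cong +_ (toℕ-fromℕ< (m%n<n a n)))) (%ℕ-≋ (+ a))

-- Residue classes and their signed representatives.

module _ {v : ℕ} .{{_ : NonZero v}} where

  embed : ℤ → ℤ/ v
  embed z = fromℕ< (n%ℕd<d z v)

  toℕ-embed : ∀ z → + toℕ (embed z) ≋ z [mod v ]
  toℕ-embed z = ≋-trans (≋-reflexive (cong +_ (toℕ-fromℕ< (n%ℕd<d z v)))) (%ℕ-≋ z)

  embed-unique : ∀ {x : ℤ/ v} {z} → + toℕ x ≋ z [mod v ] → embed z ≡ x
  embed-unique {x} {z} x≋z = toℕ-unique (≋-trans (toℕ-embed z) (≋-sym x≋z))

  signed-≋ : ∀ (x : ℤ/ v) → signed x ≋ + toℕ x [mod v ]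
  signed-≋ x with toℕ x ≤ᵇ ⌊ v /2⌋
  ... | true  = ≋-reflexive refl
  ... | false = -1ℤ wraps trans (sym (ℤ.m-n≡m⊖n (toℕ x) v))
                          (cong (ℤ._+_ (+ toℕ x)) (sym (ℤ.-1*i≡-i (+ v))))

  signed-small : ∀ {x : ℤ/ v} → toℕ x + toℕ x < v → signed x ≡ + toℕ x
  signed-small {x} 2x<v with toℕ x ≤ᵇ ⌊ v /2⌋ in eq
  ... | true  = refl
  ... | false = contradiction (subst T eq (ℕ.≤⇒≤ᵇ x≤v/2)) id
    where
    x≤v/2 : toℕ x ≤ ⌊ v /2⌋
    x≤v/2 = subst (_≤ ⌊ v /2⌋) (sym (ℕ.n≡⌊n+n/2⌋ (toℕ x))) (ℕ.⌊n/2⌋-mono (ℕ.<⇒≤ 2x<v))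

  signed-large : ∀ {x : ℤ/ v} → v < toℕ x + toℕ x → signed x ≡ toℕ x ⊖ v
  signed-large {x} v<2x with toℕ x ≤ᵇ ⌊ v /2⌋ in eq
  ... | false = refl
  ... | true  = contradiction v<2x (ℕ.≤⇒≯ (begin
    toℕ x + toℕ x       ≤⟨ ℕ.+-mono-≤ x≤v/2 (ℕ.≤-trans x≤v/2 (ℕ.⌊n/2⌋≤⌈n/2⌉ v)) ⟩
    ⌊ v /2⌋ + ⌈ v /2⌉   ≡⟨ ℕ.⌊n/2⌋+⌈n/2⌉≡n v ⟩
    v                   ∎))
    where
    open ℕ.≤-Reasoning
    x≤v/2 : toℕ x ≤ ⌊ v /2⌋
    x≤v/2 = ℕ.≤ᵇ⇒≤ _ _ (subst T (sym eq) tt)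

  -- The bound places `z` strictly inside the window of signed representatives. A nonnegative `z` is
  -- its own residue, below v / 2; a negative one has residue v - |z|, above v / 2, from which
  -- `signed` subtracts `v` again.
  signed-embed : ∀ z → ℤ.∣ z ∣ + ℤ.∣ z ∣ < v → signed (embed z) ≡ z
  signed-embed (+ k) 2k<v =
    trans (signed-small (subst (λ t → t + t < v) (sym x≡k) 2k<v)) (cong +_ x≡k)
    where
    x≡k : toℕ (embed (+ k)) ≡ k
    x≡k = residue-unique (toℕ<n (embed (+ k))) (ℕ.≤-<-trans (ℕ.m≤m+n k k) 2k<v) (toℕ-embed (+ k))
  signed-embed z@(-[1+ k ]) 2k<v = begin
    signed (embed z)    ≡⟨ signed-large (subst (λ t → v < t + t) (sym x≡) v<2x) ⟩
    toℕ (embed z) ⊖ v   ≡⟨ cong (_⊖ v) x≡ ⟩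
    (v ∸ suc k) ⊖ v     ≡⟨ ℤ.⊖-≤ (ℕ.m∸n≤m v (suc k)) ⟩
    ℤ.- + (v ∸ (v ∸ suc k))   ≡⟨ cong (λ t → ℤ.- + t) (ℕ.m∸[m∸n]≡n k<v) ⟩
    z ∎
    where
    open ≡-Reasoning
    k<v : suc k ≤ v
    k<v = ℕ.<⇒≤ (ℕ.≤-<-trans (ℕ.m≤m+n (suc k) (suc k)) 2k<v)

    x≡ : toℕ (embed z) ≡ v ∸ suc k
    x≡ = residue-unique (toℕ<n (embed z)) (ℕ.∸-monoʳ-< {v} {suc k} {0} (s≤s z≤n) k<v)
           (≋-trans (toℕ-embed z) (-1ℤ wraps trans (lemma (+ v) (+ suc k))
             (cong (ℤ._+ -1ℤ ℤ.* + v) (trans (ℤ.m-n≡m⊖n v (suc k)) (ℤ.⊖-≥ k<v)))))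
      where
      lemma : ∀ v k → ℤ.- k ≡ v ℤ.- k ℤ.+ -1ℤ ℤ.* v
      lemma = solve-∀

    v<2x : v < (v ∸ suc k) + (v ∸ suc k)
    -- Adding `suc k + suc k` to both sides leaves v + 2 (k + 1) < 2v, which is the hypothesis on
    -- `k` shifted by `v`.
    v<2x = ℕ.+-cancelʳ-< (suc k + suc k) _ _
      (ℕ.<-≤-trans (ℕ.+-monoʳ-< v 2k<v) (ℕ.≤-reflexive (begin
      v + v                                         ≡⟨ cong₂ _+_ (ℕ.m∸n+n≡m k<v) (ℕ.m∸n+n≡m k<v) ⟨
      (v ∸ suc k) + suc k + ((v ∸ suc k) + suc k)   ≡⟨ +-interchange (v ∸ suc k) (suc k) _ _ ⟩
      (v ∸ suc k) + (v ∸ suc k) + (suc k + suc k)   ∎)))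

  toℕ-⊝ : ∀ (x : ℤ/ v) → + toℕ (⊝ x) ≋ ℤ.- + toℕ x [mod v ]
  toℕ-⊝ x = ≋-trans (toℕ-mod (v ∸ toℕ x))
    (1ℤ wraps trans (sym (ℤ.⊖-≥ (ℕ.<⇒≤ (toℕ<n x))))
                    (trans (sym (ℤ.m-n≡m⊖n v (toℕ x))) (lemma (+ v) (+ toℕ x))))
    where
    lemma : ∀ v x → v ℤ.- x ≡ ℤ.- x ℤ.+ 1ℤ ℤ.* v
    lemma = solve-∀

  -- A signed representative differs from its residue by a multiple of `v`, so the two kinds of line
  -- sum agree modulo `v` and only the integer one has to be computed.
  sumMod-≋ : ∀ {n} (line : Vector (Maybe (ℤ/ v)) n) →
             + toℕ (sumMod line) ≋ sumSigned line [mod v ]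
  sumMod-≋ {zero}  line = toℕ-mod 0
  sumMod-≋ {suc n} line with line zero
  ... | nothing = sumMod-≋ (line ∘ suc)
  ... | just x  = ≋-trans (toℕ-mod _) (+-cong-≋ (≋-sym (signed-≋ x)) (sumMod-≋ (line ∘ suc)))

  sumSigned≡0⇒sumMod≡𝟘 : ∀ {n} (line : Vector (Maybe (ℤ/ v)) n) →
                         sumSigned line ≡ 0ℤ → sumMod line ≡ 𝟘
  sumSigned≡0⇒sumMod≡𝟘 line eq = toℕ-unique
    (≋-trans (sumMod-≋ line) (≋-trans (≋-reflexive eq) (≋-sym (toℕ-mod 0))))

-- The subgroup of multiples of 4.

multiplesOf4 : ∀ v → Subset v
multiplesOf4 v = Vec.tabulate (λ x → toℕ x % 4 ≡ᵇ 0)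

∈-multiplesOf4⁺ : ∀ {v} {x : ℤ/ v} → 4 ∣ toℕ x → x ∈ multiplesOf4 v
∈-multiplesOf4⁺ {v} {x} 4∣x = Vec.lookup⇒[]= x (multiplesOf4 v)
  (trans (Vec.lookup∘tabulate _ x) (cong (_≡ᵇ 0) (n∣m⇒m%n≡0 (toℕ x) 4 4∣x)))

∈-multiplesOf4⁻ : ∀ {v} {x : ℤ/ v} → x ∈ multiplesOf4 v → 4 ∣ toℕ x
∈-multiplesOf4⁻ {v} {x} x∈ = m%n≡0⇒n∣m (toℕ x) 4
  (ℕ.≡ᵇ⇒≡ _ 0 (subst T (trans (sym (Vec.[]=⇒lookup x∈)) (Vec.lookup∘tabulate _ x)) tt))

-- Each step of the induction strips the residues 0, 1, 2, 3, of which only 0 is counted. Remainders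
-- modulo 4 are unchanged by the shift definitionally, so the rest is the induction hypothesis.
∣multiplesOf4∣ : ∀ k → ∣ multiplesOf4 (k * 4) ∣ ≡ k
∣multiplesOf4∣ zero    = refl
∣multiplesOf4∣ (suc k) = cong suc (∣multiplesOf4∣ k)

multiplesOf4-isSubgroup : ∀ {v} .{{_ : NonZero v}} → 4 ∣ v → IsSubgroup (multiplesOf4 v)
multiplesOf4-isSubgroup {v} 4∣v = record
  { 𝟘-mem    = reduce 0 (4 ∣0)
  ; ⊕-closed = λ x∈ y∈ → reduce _ (∣m∣n⇒∣m+n (∈-multiplesOf4⁻ x∈) (∈-multiplesOf4⁻ y∈))
  ; ⊝-closed = λ {x} x∈ → reduce (v ∸ toℕ x)
      (∣m+n∣m⇒∣n (subst (4 ∣_) (sym (ℕ.m+[n∸m]≡n (ℕ.<⇒≤ (toℕ<n x)))) 4∣v) (∈-multiplesOf4⁻ x∈))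
  }
  where
  reduce : ∀ a → 4 ∣ a → a mod v ∈ multiplesOf4 v
  reduce a 4∣a = ∈-multiplesOf4⁺ (subst (4 ∣_) (sym (toℕ-fromℕ< (m%n<n a v))) (%-presˡ-∣ 4∣a 4∣v))

-- Cyclic shifts of the indices.

-- This is the right-hand side of `OnDiagonal`. The `NonZero` instance there comes from the row, but
-- it is an irrelevant argument, so the two agree by definition.
rotate : ∀ {n} → ℕ → Fin n → Fin n
rotate i c = ((i + toℕ c) mod _) {{nonZeroIndex c}}

toℕ-rotate : ∀ {n} i (c : Fin n) → + toℕ (rotate i c) ≋ + i ℤ.+ + toℕ c [mod n ]
toℕ-rotate i c = toℕ-mod {{nonZeroIndex c}} (i + toℕ c)

rotate-rotate : ∀ {n} i j (c : Fin n) → rotate i (rotate j c) ≡ rotate (i + j) c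
rotate-rotate i j c = toℕ-unique
  (≋-trans (toℕ-rotate i (rotate j c))
  (≋-trans (+-cong-≋ {a = + i} (≋-reflexive refl) (toℕ-rotate j c))
  (≋-trans (≋-reflexive (sym (ℤ.+-assoc (+ i) (+ j) (+ toℕ c))))
           (≋-sym (toℕ-rotate (i + j) c)))))

rotate-full : ∀ {n} (c : Fin n) → rotate n c ≡ c
rotate-full {n} c = toℕ-unique (≋-trans (toℕ-rotate n c) (1ℤ wraps lemma (+ n) (+ toℕ c)))
  where
  lemma : ∀ n c → n ℤ.+ c ≡ c ℤ.+ 1ℤ ℤ.* n
  lemma = solve-∀

rotate-∸-rotate : ∀ {n i} → i ≤ n → (c : Fin n) → rotate (n ∸ i) (rotate i c) ≡ c
rotate-∸-rotate {n} {i} i≤n c =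
  trans (rotate-rotate (n ∸ i) i c) (trans (cong (λ j → rotate j c) (ℕ.m∸n+n≡m i≤n))
                                          (rotate-full c))

rotate-rotate-∸ : ∀ {n i} → i ≤ n → (c : Fin n) → rotate i (rotate (n ∸ i) c) ≡ c
rotate-rotate-∸ {n} {i} i≤n c =
  trans (rotate-rotate i (n ∸ i) c) (trans (cong (λ j → rotate j c) (ℕ.m+[n∸m]≡n i≤n))
                                          (rotate-full c))

-- Cancelling `c` leaves a congruence between two residues below `n`. Hence distinct diagonals with
-- indices below `n` share no cell.
rotate-injectiveˡ : ∀ {n i j} {c : Fin n} → i < n → j < n → rotate i c ≡ rotate j c → i ≡ j
rotate-injectiveˡ {n} {i} {j} {c} i<n j<n eq = residue-unique i<n j<n
  (≋-cancel {+ i} {+ j} {+ toℕ c}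
    (≋-trans (≋-sym (toℕ-rotate i c))
    (≋-trans (≋-reflexive (cong (λ x → + toℕ x) eq)) (toℕ-rotate j c))))
  where
  ≋-cancel : ∀ {a b x} → a ℤ.+ x ≋ b ℤ.+ x [mod n ] → a ≋ b [mod n ]
  ≋-cancel {a} {b} {x} (q wraps eq) =
    q wraps trans (lemma₁ a x) (trans (cong (ℤ._- x) eq) (lemma₂ b x (q ℤ.* + n)))
    where
    lemma₁ : ∀ a x → a ≡ a ℤ.+ x ℤ.- x
    lemma₁ = solve-∀
    lemma₂ : ∀ b x y → b ℤ.+ x ℤ.+ y ℤ.- x ≡ b ℤ.+ y
    lemma₂ = solve-∀

-- Arrays supported on the diagonals 0, ..., k - 1.

module DiagonalArray {X : Set} {n k : ℕ} (k≤n : k ≤ n) (entry : Fin k → Fin n → X) where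

  onDiagonal? : (r c : Fin n) → Dec (∃[ j ] r ≡ rotate (toℕ j) c)
  onDiagonal? r c = any? {n = k} (λ j → r Fin.≟ rotate (toℕ j) c)

  array : PFArray X n
  array r c with onDiagonal? r c
  ... | yes (j , _) = just (entry j r)
  ... | no _        = nothing

  j<n : (j : Fin k) → toℕ j < n
  j<n j = ℕ.<-≤-trans (toℕ<n j) k≤n

  -- The array stores the entry of whichever diagonal the search returns; since the diagonals are
  -- disjoint, that can only be `j`.
  array-filled : ∀ {r c} j → r ≡ rotate (toℕ j) c → array r c ≡ just (entry j r)
  array-filled {r} {c} j eq with onDiagonal? r c
  ... | no none = contradiction (j , eq) none
  ... | yes (i , eq′) = cong (λ i → just (entry i r))
    (toℕ-injective (rotate-injectiveˡ (j<n i) (j<n j) (trans (sym eq′) eq)))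

  array-only : ∀ {r c} → Is-just (array r c) → ∃[ j ] r ≡ rotate (toℕ j) c
  array-only {r} {c} filled with onDiagonal? r c
  ... | yes found = found

  -- Diagonal `j` meets row `r` in column r - j modulo `n`, reached by rotating forward through
  -- `n ∸ toℕ j`.
  appears : ∀ j r → entry j r AppearsIn array
  appears j r = r , rotate (n ∸ toℕ j) r , array-filled j (sym (rotate-rotate-∸ (ℕ.<⇒≤ (j<n j)) r))

  row-enumerates : ∀ r → Enumerates (array r) (λ j → entry j r)
  row-enumerates r = record
    { position  = λ j → rotate (n ∸ toℕ j) r
    ; injective = λ {i} {j} eq → toℕ-injective (rotate-injectiveˡ (j<n i) (j<n j)
        (trans (rotate-rotate-∸ (ℕ.<⇒≤ (j<n i)) r)
          (trans (sym (rotate-rotate-∸ (ℕ.<⇒≤ (j<n j)) r)) (cong (rotate (toℕ j)) (sym eq)))))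
    ; filled    = λ j → array-filled j (sym (rotate-rotate-∸ (ℕ.<⇒≤ (j<n j)) r))
    ; only      = λ c filled → let j , eq = array-only filled in
        j , trans (cong (rotate (n ∸ toℕ j)) eq) (rotate-∸-rotate (ℕ.<⇒≤ (j<n j)) c)
    }

  column-enumerates : ∀ c → Enumerates (λ r → array r c) (λ j → entry j (rotate (toℕ j) c))
  column-enumerates c = record
    { position  = λ j → rotate (toℕ j) c
    ; injective = λ {i} {j} eq → toℕ-injective (rotate-injectiveˡ (j<n i) (j<n j) eq)
    ; filled    = λ j → array-filled j refl
    ; only      = λ r filled → let j , eq = array-only filled in j , sym eq
    }

  array-filledCount : EveryLine (λ line → filledCount line ≡ k) array
  array-filledCount = (λ r → filledCount-enumerated (row-enumerates r))
                    , (λ c → filledCount-enumerated (column-enumerates c))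

  array-isCyclicallyDiagonal : 1 ≤ n → IsCyclicallyDiagonal k array
  array-isCyclicallyDiagonal 1≤n = record
    { size       = k≤n
    ; start      = fromℕ< 1≤n
    ; filled-iff = λ r c → mk⇔ (forth r c) (back r c)
    }
    where
    -- The first diagonal has index 0, but while `n` is a variable this holds only propositionally.
    start+ : ∀ j → toℕ (fromℕ< 1≤n) + j ≡ j
    start+ j = cong (_+ j) (toℕ-fromℕ< 1≤n)

    forth : ∀ r c → Is-just (array r c) → ∃[ j ] j < k × OnDiagonal (toℕ (fromℕ< 1≤n) + j) r c
    forth r c filled = let j , eq = array-only filled in
      toℕ j , toℕ<n j , trans eq (cong (λ i → rotate i c) (sym (start+ (toℕ j))))

    back : ∀ r c → (∃[ j ] j < k × OnDiagonal (toℕ (fromℕ< 1≤n) + j) r c) → Is-just (array r c)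
    back r c (j , j<k , eq) = subst Is-just (sym (array-filled (fromℕ< j<k)
      (trans eq (cong (λ i → rotate i c) (trans (start+ j) (sym (toℕ-fromℕ< j<k)))))))
      (MaybeAny.just tt)

-- The sequence `φ`: bounds, sums of neighbours, and values modulo `n`.

module Construction (m : ℕ) where

  n : ℕ
  n = suc (m * 2)

  +n≡1+2m : + n ≡ 1ℤ ℤ.+ + m ℤ.* + 2
  +n≡1+2m = cong (ℤ._+_ 1ℤ) (ℤ.pos-* m 2)

  φ : ℕ → ℤ
  φ 0             = 0ℤ
  φ 1             = ℤ.- + m
  φ (suc (suc i)) = φ i ℤ.+ 1ℤ

  φ-suc : ∀ i → φ i ℤ.+ φ (suc i) ≡ + i ℤ.- + m
  φ-suc zero    = refl
  φ-suc (suc i) = trans (lemma₁ (φ (suc i)) (φ i))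
                        (trans (cong (ℤ._+_ 1ℤ) (φ-suc i)) (lemma₂ (+ i) (+ m)))
    where
    lemma₁ : ∀ a b → a ℤ.+ (b ℤ.+ 1ℤ) ≡ 1ℤ ℤ.+ (b ℤ.+ a)
    lemma₁ = solve-∀
    lemma₂ : ∀ i m → 1ℤ ℤ.+ (i ℤ.- m) ≡ 1ℤ ℤ.+ i ℤ.- m
    lemma₂ = solve-∀

  φ-even : ∀ j → φ (j * 2) ≡ + j
  φ-even zero    = refl
  φ-even (suc j) = trans (cong (ℤ._+ 1ℤ) (φ-even j)) (ℤ.+-comm (+ j) 1ℤ)

  φ-lower : ∀ i → ℤ.- + m ℤ.≤ φ i
  φ-lower 0             = ℤ.neg-≤-pos
  φ-lower 1             = ℤ.≤-refl
  φ-lower (suc (suc i)) = ℤ.≤-trans (φ-lower i) (ℤ.i≤i+j (φ i) 1ℤ)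

  -- Doubling avoids halving `i`: every second step raises `φ` by 1. For `i` at most 2m this yields
  -- the upper bound `m`.
  2φ≤ : ∀ i → φ i ℤ.* + 2 ℤ.≤ + i
  2φ≤ 0             = ℤ.≤-refl
  2φ≤ 1             = ℤ.≤-trans (ℤ.*-monoʳ-≤-nonNeg (+ 2) {ℤ.- + m} {0ℤ} ℤ.neg-≤-pos) (ℤ.+≤+ z≤n)
  2φ≤ (suc (suc i)) = ℤ.≤-trans (ℤ.≤-reflexive (lemma (φ i))) (ℤ.+-monoʳ-≤ (+ 2) (2φ≤ i))
    where
    lemma : ∀ a → (a ℤ.+ 1ℤ) ℤ.* + 2 ≡ + 2 ℤ.+ a ℤ.* + 2
    lemma = solve-∀

  ∣∣-bound : ∀ {z} → ℤ.- + m ℤ.≤ z → z ℤ.≤ + m → ℤ.∣ z ∣ ≤ m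
  ∣∣-bound {+ k}      _     z≤m = ℤ.drop‿+≤+ z≤m
  ∣∣-bound { -[1+ k ]} -m≤z _   = ℤ.drop‿+≤+ (ℤ.neg-cancel-≤ -m≤z)

  toℕ≤2m : (i : Fin n) → toℕ i ≤ m * 2
  toℕ≤2m i = s≤s⁻¹ (toℕ<n i)

  ∣φ∣≤m : (i : Fin n) → ℤ.∣ φ (toℕ i) ∣ ≤ m
  ∣φ∣≤m i = ∣∣-bound (φ-lower (toℕ i)) (ℤ.*-cancelʳ-≤-pos _ _ (+ 2)
    (ℤ.≤-trans (2φ≤ (toℕ i)) (ℤ.≤-trans (ℤ.+≤+ (toℕ≤2m i)) (ℤ.≤-reflexive (ℤ.pos-* m 2)))))

  ∣m-i∣≤m : (i : Fin n) → ℤ.∣ + m ℤ.- + toℕ i ∣ ≤ m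
  ∣m-i∣≤m i = ∣∣-bound
    (ℤ.≤-trans (ℤ.≤-reflexive (trans (lemma (+ m)) (cong (ℤ._-_ (+ m)) (sym (ℤ.pos-* m 2)))))
      (ℤ.+-monoʳ-≤ (+ m) (ℤ.neg-mono-≤ (ℤ.+≤+ (toℕ≤2m i)))))
    (ℤ.i-j≤i (+ m) (+ toℕ i))
    where
    lemma : ∀ m → ℤ.- m ≡ m ℤ.- m ℤ.* + 2
    lemma = solve-∀

  next : Fin n → Fin n
  next = rotate 1

  -- Only the wrap from 2m to 0 goes beyond `φ-suc`; there φ (2m) + φ 0 = m + 0 = 2m - m, so the
  -- same formula persists.
  φ-next : (i : Fin n) → φ (toℕ i) ℤ.+ φ (toℕ (next i)) ≡ + toℕ i ℤ.- + m
  φ-next i with suc (toℕ i) ℕ.<? n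
  ... | yes 1+i<n = trans
    (cong (λ j → φ (toℕ i) ℤ.+ φ j) (residue-unique (toℕ<n (next i)) 1+i<n (toℕ-rotate 1 i)))
    (φ-suc (toℕ i))
  ... | no 1+i≮n  = begin
    φ (toℕ i) ℤ.+ φ (toℕ (next i))  ≡⟨ cong₂ (λ i j → φ i ℤ.+ φ j) i≡2m next≡0 ⟩
    φ (m * 2) ℤ.+ 0ℤ                ≡⟨ cong (ℤ._+ 0ℤ) (φ-even m) ⟩
    + m ℤ.+ 0ℤ                      ≡⟨ lemma (+ m) ⟩
    + m ℤ.* + 2 ℤ.- + m             ≡⟨ cong (ℤ._- + m) (ℤ.pos-* m 2) ⟨
    + (m * 2) ℤ.- + m               ≡⟨ cong (λ j → + j ℤ.- + m) i≡2m ⟨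
    + toℕ i ℤ.- + m                 ∎
    where
    open ≡-Reasoning
    i≡2m : toℕ i ≡ m * 2
    i≡2m = ℕ.≤-antisym (toℕ≤2m i) (s≤s⁻¹ (ℕ.≮⇒≥ 1+i≮n))

    next≡0 : toℕ (next i) ≡ 0
    next≡0 = residue-unique (toℕ<n (next i)) (s≤s z≤n) (≋-trans (toℕ-rotate 1 i)
      (1ℤ wraps trans (cong (λ j → + suc j) i≡2m) (lemma′ (+ n))))
      where
      lemma′ : ∀ n → n ≡ 0ℤ ℤ.+ 1ℤ ℤ.* n
      lemma′ = solve-∀

    lemma : ∀ m → m ℤ.+ 0ℤ ≡ m ℤ.* + 2 ℤ.- m
    lemma = solve-∀

  -- Modulo n = 2m + 1 the inverse of 2 is m + 1, so `φ` is halving modulo `n`: two steps of the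
  -- index add 2 (m + 1) = n + 1, which is congruent to 1.
  φ-linear : ∀ i → φ i ≋ + i ℤ.* (+ m ℤ.+ 1ℤ) [mod n ]
  φ-linear 0 = ≋-reflexive refl
  φ-linear 1 = -1ℤ wraps trans (lemma (+ m))
    (cong (λ n → 1ℤ ℤ.* (+ m ℤ.+ 1ℤ) ℤ.+ -1ℤ ℤ.* n) (sym +n≡1+2m))
    where
    lemma : ∀ m → ℤ.- m ≡ 1ℤ ℤ.* (m ℤ.+ 1ℤ) ℤ.+ -1ℤ ℤ.* (1ℤ ℤ.+ m ℤ.* + 2)
    lemma = solve-∀
  φ-linear (suc (suc i)) = ≋-trans (+-cong-≋ (φ-linear i) (≋-reflexive refl))
    (-1ℤ wraps trans (lemma (+ i) (+ m))
      (cong (λ n → + (suc (suc i)) ℤ.* (+ m ℤ.+ 1ℤ) ℤ.+ -1ℤ ℤ.* n) (sym +n≡1+2m)))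
    where
    lemma : ∀ i m → i ℤ.* (m ℤ.+ 1ℤ) ℤ.+ 1ℤ ≡
                    (+ 2 ℤ.+ i) ℤ.* (m ℤ.+ 1ℤ) ℤ.+ -1ℤ ℤ.* (1ℤ ℤ.+ m ℤ.* + 2)
    lemma = solve-∀

  φ-surjective : ∀ z → ∃[ i ] φ (toℕ {n} i) ≋ z [mod n ]
  φ-surjective z = i , ≋-trans (φ-linear (toℕ i))
    (≋-trans (*-congʳ-≋ (+ m ℤ.+ 1ℤ) (toℕ-embed (z ℤ.* + 2)))
      (z wraps trans (lemma z (+ m)) (cong (λ n → z ℤ.+ z ℤ.* n) (sym +n≡1+2m))))
    where
    i : Fin n
    -- As `φ` halves modulo `n`, the preimage of `z` is the class of 2z.
    i = embed (z ℤ.* + 2)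
    lemma : ∀ z m → z ℤ.* + 2 ℤ.* (m ℤ.+ 1ℤ) ≡ z ℤ.+ z ℤ.* (1ℤ ℤ.+ m ℤ.* + 2)
    lemma = solve-∀

  m-i-surjective : ∀ z → ∃[ i ] (+ m ℤ.- + toℕ {n} i) ≋ z [mod n ]
  m-i-surjective z = embed (+ m ℤ.- z) ,
    ≋-trans (+-cong-≋ {a = + m} (≋-reflexive refl) (neg-cong-≋ (toℕ-embed (+ m ℤ.- z))))
            (≋-reflexive (lemma (+ m) z))
    where
    lemma : ∀ m z → m ℤ.- (m ℤ.- z) ≡ z
    lemma = solve-∀

  -- The integer entries, split as 8 times a block plus an offset.

  d : Fin n → ℤ
  d i = + 8 ℤ.* φ (toℕ i) ℤ.+ 1ℤ

  entry : Fin 3 → Fin n → ℤ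
  entry 0F r = d (next r) ℤ.+ + 2
  entry 1F r = ℤ.- (d r ℤ.+ d (next r))
  entry 2F r = d r ℤ.- + 2

  block : Fin 3 → Fin n → ℤ
  block 0F r = φ (toℕ (next r))
  block 1F r = + m ℤ.- + toℕ r
  block 2F r = φ (toℕ r)

  -- These represent the classes 3, 6 and 7 modulo 8 by their residues of least absolute value, as
  -- the size bound requires.
  offset : Fin 3 → ℤ
  offset 0F = + 3
  offset 1F = ℤ.- + 2
  offset 2F = -1ℤ

  entry-form : ∀ j r → entry j r ≡ + 8 ℤ.* block j r ℤ.+ offset j
  entry-form 0F r = ℤ.+-assoc (+ 8 ℤ.* φ (toℕ (next r))) 1ℤ (+ 2)
  -- The two summands 1 in the `d` terms give the offset -2, and `φ-next` evaluates the remaining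
  -- sum of neighbours as r - m.
  entry-form 1F r = trans (lemma₁ (φ (toℕ r)) (φ (toℕ (next r))))
    (trans (cong (λ s → ℤ.- (+ 8 ℤ.* s) ℤ.- + 2) (φ-next r)) (lemma₂ (+ toℕ r) (+ m)))
    where
    lemma₁ : ∀ a b → ℤ.- (+ 8 ℤ.* a ℤ.+ 1ℤ ℤ.+ (+ 8 ℤ.* b ℤ.+ 1ℤ)) ≡
                     ℤ.- (+ 8 ℤ.* (a ℤ.+ b)) ℤ.- + 2
    lemma₁ = solve-∀
    lemma₂ : ∀ i m → ℤ.- (+ 8 ℤ.* (i ℤ.- m)) ℤ.- + 2 ≡ + 8 ℤ.* (m ℤ.- i) ℤ.- + 2
    lemma₂ = solve-∀
  entry-form 2F r = ℤ.+-assoc (+ 8 ℤ.* φ (toℕ r)) 1ℤ (ℤ.- + 2)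

  ∣block∣≤m : ∀ j r → ℤ.∣ block j r ∣ ≤ m
  ∣block∣≤m 0F r = ∣φ∣≤m (next r)
  ∣block∣≤m 1F r = ∣m-i∣≤m r
  ∣block∣≤m 2F r = ∣φ∣≤m r

  ∣offset∣≤3 : ∀ j → ℤ.∣ offset j ∣ ≤ 3
  ∣offset∣≤3 0F = ℕ.≤-refl
  ∣offset∣≤3 1F = s≤s (s≤s z≤n)
  ∣offset∣≤3 2F = s≤s z≤n

  block-surjective : ∀ j z → ∃[ r ] block j r ≋ z [mod n ]
  -- Since 1 + 2m = n, rotating by `m * 2` inverts `next`.
  block-surjective 0F z = let i , φi≋z = φ-surjective z in
    rotate (m * 2) i , subst (λ k → φ (toℕ k) ≋ z [mod n ])
                             (sym (trans (rotate-rotate 1 (m * 2) i) (rotate-full i))) φi≋z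
  block-surjective 1F z = m-i-surjective z
  block-surjective 2F z = φ-surjective z

  -- The modulus and the size of the entries.

  v : ℕ
  v = modulus (2 * n) n 3

  v≡2n*4 : v ≡ 2 * n * 4
  v≡2n*4 = lemma n
    where
    lemma : ∀ n → 2 * n * 3 + 2 * n ≡ 2 * n * 4
    lemma = ℕ-solve-∀

  v≡16m+8 : v ≡ m * 16 + 8
  v≡16m+8 = lemma m
    where
    lemma : ∀ m → 2 * suc (m * 2) * 3 + 2 * suc (m * 2) ≡ m * 16 + 8
    lemma = ℕ-solve-∀

  +v≡8n : + v ≡ + n ℤ.* + 8
  +v≡8n = trans (cong +_ (trans v≡2n*4 (lemma n))) (ℤ.pos-* n 8)
    where
    lemma : ∀ n → 2 * n * 4 ≡ n * 8
    lemma = ℕ-solve-∀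

  -- Blocks are at most `m` and offsets at most 3 in absolute value, and twice 8m + 3 is 16m + 6,
  -- two short of `v`.
  entry-small : ∀ j r → ℤ.∣ entry j r ∣ + ℤ.∣ entry j r ∣ < v
  entry-small j r = begin-strict
    ℤ.∣ entry j r ∣ + ℤ.∣ entry j r ∣    ≤⟨ ℕ.+-mono-≤ bound bound ⟩
    (8 * m + 3) + (8 * m + 3)            <⟨ s≤s (ℕ.n≤1+n _) ⟩
    2 + ((8 * m + 3) + (8 * m + 3))      ≡⟨ lemma m ⟩
    m * 16 + 8                           ≡⟨ v≡16m+8 ⟨
    v                                    ∎
    where
    open ℕ.≤-Reasoning
    bound : ℤ.∣ entry j r ∣ ≤ 8 * m + 3
    bound = begin
      ℤ.∣ entry j r ∣
        ≡⟨ cong ℤ.∣_∣ (entry-form j r) ⟩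
      ℤ.∣ + 8 ℤ.* block j r ℤ.+ offset j ∣
        ≤⟨ ℤ.∣i+j∣≤∣i∣+∣j∣ (+ 8 ℤ.* block j r) (offset j) ⟩
      ℤ.∣ + 8 ℤ.* block j r ∣ + ℤ.∣ offset j ∣
        ≡⟨ cong (_+ ℤ.∣ offset j ∣) (ℤ.abs-* (+ 8) (block j r)) ⟩
      8 * ℤ.∣ block j r ∣ + ℤ.∣ offset j ∣
        ≤⟨ ℕ.+-mono-≤ (ℕ.*-monoʳ-≤ 8 (∣block∣≤m j r)) (∣offset∣≤3 j) ⟩
      8 * m + 3 ∎
    lemma : ∀ m → 2 + ((8 * m + 3) + (8 * m + 3)) ≡ m * 16 + 8
    lemma = ℕ-solve-∀

  cell : Fin 3 → Fin n → ℤ/ v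
  cell j r = embed (entry j r)

  -- Line sums, covering of the complement of J, and the Heffter conditions.

  module _ (3≤n : 3 ≤ n) where

    open DiagonalArray 3≤n cell public

    sumSigned-entries : (r : Fin 3 → Fin n) →
                        ℤ-Sum.sum (λ j → signed (cell j (r j))) ≡ ℤ-Sum.sum (λ j → entry j (r j))
    sumSigned-entries r = ℤ-Sum.sum-cong-≗ {3}
      (λ j → signed-embed (entry j (r j)) (entry-small j (r j)))

    isInteger : IsInteger array
    isInteger =
        (λ r → trans (sumSigned-enumerated (row-enumerates r))
                     (trans (sumSigned-entries (λ _ → r)) (row-sum (d r) (d (next r)))))
      , (λ c → trans (sumSigned-enumerated (column-enumerates c))
                     (trans (sumSigned-entries (λ j → rotate (toℕ j) c)) (column-sum c)))
      where
      row-sum : ∀ a b → b ℤ.+ + 2 ℤ.+ (ℤ.- (a ℤ.+ b) ℤ.+ (a ℤ.- + 2 ℤ.+ 0ℤ)) ≡ 0ℤ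
      row-sum = solve-∀

      column-sum : ∀ c → ℤ-Sum.sum (λ j → entry j (rotate (toℕ j) c)) ≡ 0ℤ
      -- Column `c` meets the diagonals in rows c, c + 1 and c + 2, so its entries involve only d (c
      -- + 1) and d (c + 2), each once with either sign.
      column-sum c = trans
        (cong₂ (λ a b → d a ℤ.+ + 2 ℤ.+ (ℤ.- (d (rotate 1 c) ℤ.+ d b) ℤ.+
                          (d (rotate 2 c) ℤ.- + 2 ℤ.+ 0ℤ)))
               (rotate-rotate 1 0 c) (rotate-rotate 1 1 c))
        (lemma (d (rotate 1 c)) (d (rotate 2 c)))
        where
        lemma : ∀ a b → a ℤ.+ + 2 ℤ.+ (ℤ.- (a ℤ.+ b) ℤ.+ (b ℤ.- + 2 ℤ.+ 0ℤ)) ≡ 0ℤ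
        lemma = solve-∀

    -- A congruence of blocks modulo `n`, multiplied by 8, becomes one modulo 8n = v; hence each
    -- diagonal exhausts its class modulo 8.
    class-appears : ∀ j z {x : ℤ/ v} →
                    + toℕ x ≋ + 8 ℤ.* z ℤ.+ offset j [mod v ] → x AppearsIn array
    class-appears j z {x} x≋ with block-surjective j z
    ... | r , (q wraps eq) = subst (_AppearsIn array)
      (embed-unique {z = entry j r} (≋-trans x≋ (≋-sym entry≋))) (appears j r)
      where
      entry≋ : entry j r ≋ + 8 ℤ.* z ℤ.+ offset j [mod v ]
      entry≋ = q wraps trans (entry-form j r) (trans (cong (λ b → + 8 ℤ.* b ℤ.+ offset j) eq)
        (trans (lemma z q (+ n) (offset j))
               (cong (λ v → + 8 ℤ.* z ℤ.+ offset j ℤ.+ q ℤ.* v) (sym +v≡8n))))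
        where
        lemma : ∀ z q n s → + 8 ℤ.* (z ℤ.+ q ℤ.* n) ℤ.+ s ≡ + 8 ℤ.* z ℤ.+ s ℤ.+ q ℤ.* (n ℤ.* + 8)
        lemma = solve-∀

    covers : ∀ x → x ∉ multiplesOf4 v → (x AppearsIn array) ⊎ ((⊝ x) AppearsIn array)
    -- The remainder modulo 8 is passed on together with its bound and equation, so that it can be
    -- matched on.
    covers x x∉ = by-class (toℕ x % 8) (m%n<n (toℕ x) 8) (m≡m%n+[m/n]*n (toℕ x) 8)
      where
      k = toℕ x / 8

      itself : ∀ j z {s} → toℕ x ≡ s + k * 8 →
               + s ℤ.+ + k ℤ.* + 8 ≡ + 8 ℤ.* z ℤ.+ offset j → x AppearsIn array
      itself j z {s} eq eq′ = class-appears j z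
        (≋-reflexive (trans (cong +_ eq) (trans (cong (ℤ._+_ (+ s)) (ℤ.pos-* k 8)) eq′)))

      negated : ∀ j z {s} → toℕ x ≡ s + k * 8 →
                ℤ.- (+ s ℤ.+ + k ℤ.* + 8) ≡ + 8 ℤ.* z ℤ.+ offset j → (⊝ x) AppearsIn array
      negated j z {s} eq eq′ = class-appears j z (≋-trans (toℕ-⊝ x)
        (≋-reflexive (trans (cong (λ t → ℤ.- + t) eq)
                            (trans (cong (λ t → ℤ.- (+ s ℤ.+ t)) (ℤ.pos-* k 8)) eq′))))

      in-J : ∀ q → toℕ x ≡ q * 4 + k * 8 → x ∈ multiplesOf4 v
      in-J q eq = ∈-multiplesOf4⁺ (divides (q + k * 2) (trans eq (lemma q k)))
        where
        lemma : ∀ q k → q * 4 + k * 8 ≡ (q + k * 2) * 4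
        lemma = ℕ-solve-∀

      by-class : ∀ s → s < 8 → toℕ x ≡ s + k * 8 → (x AppearsIn array) ⊎ ((⊝ x) AppearsIn array)
      by-class 0 _ eq = contradiction (in-J 0 eq) x∉
      by-class 1 _ eq = inj₂ (negated 2F (ℤ.- + k) eq (lemma (+ k)))
        where
        lemma : ∀ k → ℤ.- (1ℤ ℤ.+ k ℤ.* + 8) ≡ + 8 ℤ.* ℤ.- k ℤ.+ -1ℤ
        lemma = solve-∀
      by-class 2 _ eq = inj₂ (negated 1F (ℤ.- + k) eq (lemma (+ k)))
        where
        lemma : ∀ k → ℤ.- (+ 2 ℤ.+ k ℤ.* + 8) ≡ + 8 ℤ.* ℤ.- k ℤ.- + 2
        lemma = solve-∀
      by-class 3 _ eq = inj₁ (itself 0F (+ k) eq (lemma (+ k)))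
        where
        lemma : ∀ k → + 3 ℤ.+ k ℤ.* + 8 ≡ + 8 ℤ.* k ℤ.+ + 3
        lemma = solve-∀
      by-class 4 _ eq = contradiction (in-J 1 eq) x∉
      -- Here -(8k + 5) = 8 (-k - 1) + 3, so the block is one lower than `- k`.
      by-class 5 _ eq = inj₂ (negated 0F (ℤ.- + k ℤ.- 1ℤ) eq (lemma (+ k)))
        where
        lemma : ∀ k → ℤ.- (+ 5 ℤ.+ k ℤ.* + 8) ≡ + 8 ℤ.* (ℤ.- k ℤ.- 1ℤ) ℤ.+ + 3
        lemma = solve-∀
      -- The classes 6 and 7 have the negative offsets -2 and -1, which moves the block up to k + 1.
      by-class 6 _ eq = inj₁ (itself 1F (+ k ℤ.+ 1ℤ) eq (lemma (+ k)))
        where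
        lemma : ∀ k → + 6 ℤ.+ k ℤ.* + 8 ≡ + 8 ℤ.* (k ℤ.+ 1ℤ) ℤ.- + 2
        lemma = solve-∀
      by-class 7 _ eq = inj₁ (itself 2F (+ k ℤ.+ 1ℤ) eq (lemma (+ k)))
        where
        lemma : ∀ k → + 7 ℤ.+ k ℤ.* + 8 ≡ + 8 ℤ.* (k ℤ.+ 1ℤ) ℤ.+ -1ℤ
        lemma = solve-∀
      by-class (suc (suc (suc (suc (suc (suc (suc (suc _))))))))
               (s≤s (s≤s (s≤s (s≤s (s≤s (s≤s (s≤s (s≤s ())))))))) _

    isHeffter : IsHeffter (2 * n) n 3 array
    isHeffter = record
      { 3≤k        = ℕ.≤-refl
      ; k≤n        = 3≤n
      ; t∣2nk      = m∣m*n 3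
      ; J          = multiplesOf4 v
      ; J-subgroup = multiplesOf4-isSubgroup (divides (2 * n) v≡2n*4)
      ; J-order    = trans (cong (λ v → ∣ multiplesOf4 v ∣) v≡2n*4) (∣multiplesOf4∣ (2 * n))
      ; k-filled   = array-filledCount
      ; covers     = covers
      ; sums-to-0  = (λ r → sumSigned≡0⇒sumMod≡𝟘 (array r) (proj₁ isInteger r))
                   , (λ c → sumSigned≡0⇒sumMod≡𝟘 (λ r → array r c) (proj₂ isInteger c))
      }

-- Passage from odd `n` to the form 2m + 1.

odd⇒suc-double : ∀ {n} → n % 2 ≡ 1 → ∃[ m ] n ≡ suc (m * 2)
odd⇒suc-double {n} odd = n / 2 , trans (m≡m%n+[m/n]*n n 2) (cong (_+ n / 2 * 2) odd)

proposition4p3 : ∀ (n : ℕ) → 3 ≤ n → n % 2 ≡ 1 →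
    ∃[ A ] (IsHeffter (2 * n) n 3 A × IsInteger A × IsCyclicallyDiagonal 3 A)
proposition4p3 n 3≤n odd with odd⇒suc-double {n} odd
... | m , refl =
  array 3≤n , isHeffter 3≤n , isInteger 3≤n , array-isCyclicallyDiagonal 3≤n (s≤s z≤n)
  where open Construction m
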